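{- For any $n \in \mathbb{N} \setminus \{1\}$, there exists a graph $G$ on $\Theta(n)$ vertices such that $\mathrm{eq}(G) = \Omega(n)$ and $\mathrm{pq}(G) = O(\log n)$.
   Context: Query game on a simple graph $G=(V,E)$: $d_G(u,v)$ denotes the graph distance. An adversary fixes a target vertex $v^*\in V$ unknown to an adaptive algorithm. In each round the algorithm queries two vertices $u,v$, and the adversary replies with whichever of $u,v$ is closer to $v^*$ (with either one, at the adversary's choice, if $d_G(u,v^*)=d_G(v,v^*)$). Equivalently: put $V_0=V$; in round $t$ the algorithm presents $(u_t,v_t)$ (depending on $G$ and earlier replies) and the adversary chooses either $V_t=\{x\in V_{t-1}: d_G(u_t,x)\le d_G(v_t,x)\}$ (reply $u_t$) or $V_t=\{x\in V_{t-1}: d_G(v_t,x)\le d_G(u_t,x)\}$ (reply $v_t$); the target is located once $|V_t|=1$. A pair query allows arbitrary $u,v\in V$; an edge query requires $u$ and $v$ to be adjacent. $\mathrm{pq}(G)$ (respectively $\mathrm{eq}(G)$) is the least integer $t$ such that the algorithm can locate the target in at most $t$ pair queries (respectively edge queries), regardless of the strategy of the adversary. $\mathbb{N}=\{1,2,\dots\}$; the constants hidden in $\Theta(\cdot)$, $\Omega(\cdot)$, $O(\cdot)$ are absolute (positive and independent of $n$). -}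

module Defs where

open import Data.Bool using (if_then_else_)
open import Data.Empty using (⊥-elim)
open import Data.Fin using (Fin; zero; suc; toℕ)
import Data.Fin.Properties as Fin
open import Data.Fin.Subset using (Subset; Nonempty; ∣_∣; _∩_) renaming (⊤ to full)
open import Data.Maybe using (map)
open import Data.Nat using (ℕ; zero; suc; _+_; _∸_; _≤_; _<_; _≤?_; z≤n; s≤s)
open import Data.Nat.Induction using (<-wellFounded)
open import Data.Nat.Properties
open import Data.Product using (Σ-syntax; _×_; _,_)
open import Data.Unit using (⊤)
open import Data.Vec using (tabulate)
open import Function using (_∘_)
open import Induction.WellFounded using (Acc; acc)
open import Level using (0ℓ)
open import Relation.Binary using (Rel; Symmetric; Irreflexive)
import Relation.Binary as B
open import Relation.Binary.PropositionalEquality using (_≡_; refl; sym; subst)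
open import Relation.Nullary using (yes; no; does)
open import Relation.Nullary.Construct.Add.Supremum using (_⁺; ⊤⁺; [_])
open import Relation.Nullary.Decidable using (map′; _×-dec_)
open import Relation.Unary using (Pred; Decidable)
open import Relation.Binary.Construct.Add.Supremum.NonStrict _≤_
  using (_≤⁺_; [_]; ≤⁺-dec)

record SimpleGraph (m : ℕ) : Set₁ where
  field
    Adj         : Rel (Fin m) 0ℓ
    adj?        : B.Decidable Adj
    symmetric   : Symmetric Adj
    irreflexive : Irreflexive _≡_ Adj

IsLeast : Pred ℕ 0ℓ → Pred ℕ 0ℓ
IsLeast P t = P t × (∀ s → P s → t ≤ s)

-- The least k < b satisfying P, and ⊤⁺ (that is, ∞) if there is none.
leastBelow : {P : Pred ℕ 0ℓ} → Decidable P → ℕ → ℕ ⁺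
leastBelow P? zero    = ⊤⁺
leastBelow P? (suc b) =
  if does (P? 0) then [ 0 ] else map suc (leastBelow (P? ∘ suc) b)

leastBelow-sound : {P : Pred ℕ 0ℓ} (P? : Decidable P) (b : ℕ) {k : ℕ} →
                   leastBelow P? b ≡ [ k ] → P k
leastBelow-sound P? (suc b) eq with P? 0
leastBelow-sound P? (suc b) refl | yes p = p
... | no _ with leastBelow (P? ∘ suc) b in eq′
leastBelow-sound P? (suc b) refl | no _ | [ k ] = leastBelow-sound (P? ∘ suc) b eq′

leastBelow-minimal : {P : Pred ℕ 0ℓ} (P? : Decidable P) (b : ℕ) {k : ℕ} →
                     k < b → P k → leastBelow P? b ≤⁺ [ k ]
leastBelow-minimal P? (suc b) {k} k<b p with P? 0
... | yes _ = [ z≤n ]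
leastBelow-minimal P? (suc b) {zero}  k<b p | no ¬p = ⊥-elim (¬p p)
leastBelow-minimal P? (suc b) {suc k} (s≤s k<b) p | no _
  with leastBelow (P? ∘ suc) b | leastBelow-minimal (P? ∘ suc) b k<b p
... | [ j ] | [ j≤k ] = [ s≤s j≤k ]

module _ {m : ℕ} (G : SimpleGraph m) where
  open SimpleGraph G

  data Walk : Fin m → Fin m → ℕ → Set where
    []  : ∀ {u} → Walk u u 0
    _∷_ : ∀ {u w v k} → Adj u w → Walk w v k → Walk u v (suc k)

  walk? : ∀ u v → Decidable (Walk u v)
  walk? u v zero    = map′ (λ { refl → [] }) (λ { [] → refl }) (u Fin.≟ v)
  walk? u v (suc k) = map′ (λ { (_ , a , w) → a ∷ w }) (λ { (a ∷ w) → _ , a , w })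
                           (Fin.any? λ w → adj? u w ×-dec walk? w v k)

  -- The length of a shortest walk, ∞ if there is none. A shortest walk repeats
  -- no vertex, so lengths below m suffice; dist-sound and dist-minimal confirm
  -- that the bound is harmless.
  dist : Fin m → Fin m → ℕ ⁺
  dist u v = leastBelow (walk? u v) m

  -- Keeping x when d(u,x) ≤ d(v,x): what remains possible after the reply u to
  -- a query of u and v.
  closer : Fin m → Fin m → Subset m
  closer u v = tabulate λ x → does (≤⁺-dec _≤?_ (dist u x) (dist v x))

  -- With S the set of targets consistent with the replies so far, the
  -- algorithm can locate the target in at most t further queries {u,v}
  -- satisfying Q. Replies have to be truthful about an actual target, so a
  -- reply leaving no possible target is unavailable to the adversary; this is
  -- the role of Nonempty.
  data Locatable (Q : Rel (Fin m) 0ℓ) : ℕ → Subset m → Set where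
    located : ∀ {t S} → ∣ S ∣ ≡ 1 → Locatable Q t S
    query   : ∀ {t S} u v → Q u v →
              (Nonempty (S ∩ closer u v) → Locatable Q t (S ∩ closer u v)) →
              (Nonempty (S ∩ closer v u) → Locatable Q t (S ∩ closer v u)) →
              Locatable Q (suc t) S

  -- Relations rather than functions: on a disconnected graph no number of edge
  -- queries suffices, so eq(G) need not exist.
  IsPq : Pred ℕ 0ℓ
  IsPq = IsLeast λ t → Locatable (λ _ _ → ⊤) t full

  IsEq : Pred ℕ 0ℓ
  IsEq = IsLeast λ t → Locatable Adj t full

  private
    _++_ : ∀ {u v w k l} → Walk u v k → Walk v w l → Walk u w (k + l)
    []      ++ q = q
    (a ∷ p) ++ q = a ∷ (p ++ q)

    at : ∀ {u v k} → Walk u v k → Fin (suc k) → Fin m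
    at {u = u} p zero    = u
    at (a ∷ p) (suc i)   = at p i

    take : ∀ {u v k} (p : Walk u v k) i → Walk u (at p i) (toℕ i)
    take p       zero    = []
    take (a ∷ p) (suc i) = a ∷ take p i

    drop : ∀ {u v k} (p : Walk u v k) i → Walk (at p i) v (k ∸ toℕ i)
    drop p       zero    = p
    drop (a ∷ p) (suc i) = drop p i

    splice-< : ∀ {i j k} → i < j → j ≤ k → i + (k ∸ j) < k
    splice-< {i} {j} {k} i<j j≤k =
      subst (i + (k ∸ j) <_) (m+[n∸m]≡n j≤k) (+-monoˡ-< (k ∸ j) i<j)

    shorten : ∀ {u v k} → Acc _<_ k → Walk u v k →
              Σ[ l ∈ ℕ ] l ≤ k × l < m × Walk u v l
    shorten {k = k} (acc rs) p with suc k ≤? m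
    ... | yes k<m = k , ≤-refl , k<m , p
    ... | no  k≮m
      with i , j , i<j , eq ← Fin.pigeonhole (≰⇒> k≮m) (at p)
      with lt ← splice-< i<j (Fin.toℕ≤pred[n] j)
      with l , l≤ , l<m , q ← shorten (rs lt)
             (take p i ++ subst (λ x → Walk x _ _) (sym eq) (drop p j))
      = l , ≤-trans l≤ (<⇒≤ lt) , l<m , q

  dist-sound : ∀ {u v k} → dist u v ≡ [ k ] → Walk u v k
  dist-sound {u} {v} = leastBelow-sound (walk? u v) m

  dist-minimal : ∀ {u v k} → Walk u v k → dist u v ≤⁺ [ k ]
  dist-minimal {u} {v} p
    with l , l≤k , l<m , q ← shorten (<-wellFounded _) p
    with dist u v | leastBelow-minimal (walk? u v) m l<m q
  ... | [ d ] | [ d≤l ] = [ ≤-trans d≤l l≤k ]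

{-# OPTIONS --safe #-}

-- Take 2^k leaves, two tests for each of the k binary digits of a leaf (one per
-- value of the digit, adjacent to the leaves having it), and a hub adjacent to
-- everything. Every leaf is at distance at most 2 from every vertex, so
-- whichever edge is queried, one of the two replies discards at most one leaf,
-- and 2^k - 1 edge queries may be needed. Querying the two tests of each digit
-- leaves one leaf and the 2k + 1 other vertices, which can be discarded one by
-- one: querying two possible targets always discards one of them.
module Submission where

open import Defs
open import Data.Fin using (Fin; zero; suc; combine; funToFin; finToFun)
open import Data.Fin.Properties as Fin using (+↔⊎; *↔×; 1↔⊤; funToFin-finToFin)
open import Data.Fin.Subset
  using (Subset; Nonempty; ∣_∣; Side; _∈_; _∉_; _⊆_; _∩_; _∪_; ⁅_⁆; inside; outside)
  renaming (⊤ to full)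
open import Data.Fin.Subset.Properties
  using (_∈?_; ∈⊤; nonempty?; x∈⁅x⁆; x∈⁅y⁆⇒x≡y; ∣⁅x⁆∣≡1; ∣⊤∣≡n; ∣⊥∣≡0;
         Empty-unique; p⊆q⇒∣p∣≤∣q∣; p⊂q⇒∣p∣<∣q∣; p∩q⊆p; p∩q⊆q; x∈p∩q⁺; x∈p∪q⁺)
open import Data.List using ([]; _∷_; length; allFin)
open import Data.List.Properties using (length-tabulate)
open import Data.List.Membership.Propositional using () renaming (_∈_ to _∈ˡ_)
open import Data.List.Membership.Propositional.Properties using (∈-allFin)
open import Data.List.Relation.Unary.Any using (here; there)
open import Data.Nat
  using (ℕ; zero; suc; _+_; _*_; _^_; _≤_; _<_; _≤?_; z≤n; s≤s; s≤s⁻¹)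
open import Data.Nat.Logarithm using (⌊log₂_⌋; ⌊log₂⌋-mono-≤; ⌊log₂[2^n]⌋≡n)
open import Data.Nat.Properties
open import Data.Product using (∃-syntax; Σ-syntax; _×_; _,_; proj₁; proj₂)
open import Data.Sum using (_⊎_; inj₁; inj₂; swap; [_,_]′)
open import Data.Sum.Function.Propositional using (_⊎-↔_)
open import Data.Unit using (⊤; tt)
open import Data.Vec using ([]; _∷_; tabulate)
open import Data.Vec.Properties using (lookup∘tabulate; []=⇒lookup; lookup⇒[]=)
open import Function using (_∘_; _↔_; Inverse)
open import Function.Construct.Composition using (_↔-∘_)
open import Function.Construct.Identity using (↔-id)
open import Level using (0ℓ)
open import Relation.Binary using (Rel)
import Relation.Binary as B
open import Relation.Binary.Construct.Add.Supremum.NonStrict _≤_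
  using (_≤⁺_; [_]; _≤⊤⁺; ≤⁺-dec)
open import Relation.Binary.PropositionalEquality
  using (_≡_; _≢_; refl; sym; trans; cong; cong₂; subst; subst₂)
open import Relation.Nullary using (¬_; Dec; yes; no; contradiction)
open import Relation.Nullary.Construct.Add.Supremum using (⊤⁺; [_])
open import Relation.Nullary.Decidable
  using (map′; _×-dec_; _⊎-dec_; _→-dec_; ¬?; dec-true; decidable-stable)
open import Relation.Unary using (Pred; Decidable)

-- Least witnesses and counting in finite subsets

least : {P : Pred ℕ 0ℓ} → Decidable P → ∀ t → P t → ∃[ s ] IsLeast P s
least P? t p with P? 0
... | yes p₀ = 0 , p₀ , λ _ _ → z≤n
least P? zero    p | no ¬p₀ = contradiction p ¬p₀
least P? (suc t) p | no ¬p₀ with s , ps , min ← least (P? ∘ suc) t p =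
  suc s , ps , λ { zero p₀ → contradiction p₀ ¬p₀ ; (suc r) pr → s≤s (min r pr) }

∣p∪q∣≤∣p∣+∣q∣ : ∀ {n} (p q : Subset n) → ∣ p ∪ q ∣ ≤ ∣ p ∣ + ∣ q ∣
∣p∪q∣≤∣p∣+∣q∣ []            []            = z≤n
∣p∪q∣≤∣p∣+∣q∣ (outside ∷ p) (outside ∷ q) = ∣p∪q∣≤∣p∣+∣q∣ p q
∣p∪q∣≤∣p∣+∣q∣ (outside ∷ p) (inside  ∷ q) =
  ≤-trans (s≤s (∣p∪q∣≤∣p∣+∣q∣ p q)) (≤-reflexive (sym (+-suc ∣ p ∣ ∣ q ∣)))
∣p∪q∣≤∣p∣+∣q∣ (inside  ∷ p) (outside ∷ q) = s≤s (∣p∪q∣≤∣p∣+∣q∣ p q)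
∣p∪q∣≤∣p∣+∣q∣ (inside  ∷ p) (inside  ∷ q) =
  s≤s (≤-trans (∣p∪q∣≤∣p∣+∣q∣ p q) (+-monoʳ-≤ ∣ p ∣ (n≤1+n ∣ q ∣)))

-- Induction on `c` moves the points `g i` into `q` one at a time, each raising its size by at most
-- one. `g` may repeat values or hit `q`.
covered : ∀ {n} c (g : Fin c → Fin n) {p q : Subset n} →
          (∀ {x} → x ∈ p → x ∈ q ⊎ ∃[ i ] g i ≡ x) → ∣ p ∣ ≤ c + ∣ q ∣
covered zero g cov =
  p⊆q⇒∣p∣≤∣q∣ λ x∈p → [ (λ x∈q → x∈q) , (λ ()) ]′ (cov x∈p)
covered (suc c) g {p} {q} cov = begin
  ∣ p ∣                     ≤⟨ covered c (g ∘ suc) cov′ ⟩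
  c + ∣ q ∪ ⁅ g zero ⁆ ∣     ≤⟨ +-monoʳ-≤ c (∣p∪q∣≤∣p∣+∣q∣ q ⁅ g zero ⁆) ⟩
  c + (∣ q ∣ + ∣ ⁅ g zero ⁆ ∣) ≡⟨ cong (λ s → c + (∣ q ∣ + s)) (∣⁅x⁆∣≡1 (g zero)) ⟩
  c + (∣ q ∣ + 1)           ≡⟨ cong (c +_) (+-comm ∣ q ∣ 1) ⟩
  c + suc ∣ q ∣             ≡⟨ +-suc c ∣ q ∣ ⟩
  suc c + ∣ q ∣             ∎
  where
  open ≤-Reasoning
  cov′ : ∀ {x} → x ∈ p → x ∈ q ∪ ⁅ g zero ⁆ ⊎ ∃[ i ] g (suc i) ≡ x
  cov′ x∈p with cov x∈p
  ... | inj₁ x∈q            = inj₁ (x∈p∪q⁺ (inj₁ x∈q))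
  ... | inj₂ (zero  , refl) = inj₁ (x∈p∪q⁺ (inj₂ (x∈⁅x⁆ _)))
  ... | inj₂ (suc i , eq)   = inj₂ (i , eq)

Nonempty⇒∣p∣≥1 : ∀ {n} {p : Subset n} → Nonempty p → 1 ≤ ∣ p ∣
Nonempty⇒∣p∣≥1 {p = p} (x , x∈p) =
  ≤-trans (≤-reflexive (sym (∣⁅x⁆∣≡1 x)))
          (p⊆q⇒∣p∣≤∣q∣ λ y∈ → subst (_∈ p) (sym (x∈⁅y⁆⇒x≡y x y∈)) x∈p)

funToFin-cong : ∀ {m n} {f g : Fin m → Fin n} →
                (∀ i → f i ≡ g i) → funToFin f ≡ funToFin g
funToFin-cong {zero}  f≗g = refl
funToFin-cong {suc m} f≗g = cong₂ combine (f≗g zero) (funToFin-cong (f≗g ∘ suc))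

singleton⊎distinct : ∀ {n} {p : Subset n} → Nonempty p →
  ∣ p ∣ ≡ 1 ⊎ ∃[ x ] ∃[ y ] x ∈ p × y ∈ p × x ≢ y
singleton⊎distinct {p = p} ne@(x , x∈p)
  with Fin.any? (λ y → y ∈? p ×-dec ¬? (x Fin.≟ y))
... | yes (y , y∈p , x≢y) = inj₂ (x , y , x∈p , y∈p , x≢y)
... | no ¬∃ = inj₁ (≤-antisym (≤-trans (p⊆q⇒∣p∣≤∣q∣ p⊆⁅x⁆) (≤-reflexive (∣⁅x⁆∣≡1 x)))
                              (Nonempty⇒∣p∣≥1 ne))
  where
  p⊆⁅x⁆ : p ⊆ ⁅ x ⁆
  p⊆⁅x⁆ {y} y∈p = subst (_∈ ⁅ x ⁆)
    (decidable-stable (x Fin.≟ y) λ x≢y → ¬∃ (y , y∈p , x≢y)) (x∈⁅x⁆ x)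

∣p∩q∣<∣p∣ : ∀ {n} {p q : Subset n} {x} → x ∈ p → x ∉ q → ∣ p ∩ q ∣ < ∣ p ∣
∣p∩q∣<∣p∣ {p = p} {q} x∈p x∉q =
  p⊂q⇒∣p∣<∣q∣ (p∩q⊆p p q , _ , x∈p , x∉q ∘ p∩q⊆q p q)

-- Replies, walks and separating queries on an arbitrary graph

module _ {m : ℕ} (G : SimpleGraph m) where
  open SimpleGraph G

  -- The walk makes the distance from `v` finite, hence also the smaller one from `u`, which a walk
  -- realises. With the converse below, later arguments handle walks only and never `dist`.
  ∈-closer⁻ : ∀ u v {x k} → x ∈ closer G u v → Walk G v x k →
              ∃[ l ] l ≤ k × Walk G u x l
  ∈-closer⁻ u v {x} x∈ w
    with ≤⁺-dec _≤?_ (dist G u x) (dist G v x)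
       | trans (sym (lookup∘tabulate _ x)) ([]=⇒lookup x∈)
  ... | yes le | _
    with dist G u x in equ | dist G v x | le | dist-minimal G w
  ... | [ l ] | [ _ ] | [ l≤d ] | [ d≤k ] = l , ≤-trans l≤d d≤k , dist-sound G equ

  ∈-closer⁺ : ∀ {u v x} →
              (∀ {k} → Walk G v x k → ∃[ l ] l ≤ k × Walk G u x l) → x ∈ closer G u v
  ∈-closer⁺ {u} {v} {x} f =
    lookup⇒[]= x _ (trans (lookup∘tabulate _ x) (dec-true (≤⁺-dec _≤?_ _ _) le))
    where
    le : dist G u x ≤⁺ dist G v x
    le with dist G v x in eqv
    ... | ⊤⁺ = _ ≤⊤⁺
    ... | [ k ] with l , l≤k , w ← f (dist-sound G eqv)
                with dist G u x | dist-minimal G w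
    ... | [ d ] | [ d≤l ] = [ ≤-trans d≤l l≤k ]

  v∉closer-u-v : ∀ {u v} → u ≢ v → v ∉ closer G u v
  v∉closer-u-v {u} {v} u≢v v∈ with ∈-closer⁻ u v v∈ []
  ... | zero , _ , [] = u≢v refl

  -- There are finitely many queries, so the game tree of depth `t` can be searched; this is what
  -- lets `least` produce the exact query numbers.
  locatable? : ∀ {Q} → B.Decidable Q → ∀ t → Decidable (Locatable G Q t)
  locatable? Q? zero S = map′ located (λ { (located eq) → eq }) (∣ S ∣ ≟ 1)
  locatable? {Q} Q? (suc t) S = map′
    [ located , (λ (u , v , q , l , r) → query u v q l r) ]′
    (λ { (located eq) → inj₁ eq ; (query u v q l r) → inj₂ (u , v , q , l , r) })
    (∣ S ∣ ≟ 1 ⊎-dec Fin.any? λ u → Fin.any? λ v →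
      Q? u v ×-dec continue? u v ×-dec continue? v u)
    where
    continue? : ∀ u v → Dec (Nonempty (S ∩ closer G u v) → Locatable G Q t (S ∩ closer G u v))
    continue? u v = nonempty? _ →-dec locatable? Q? t (S ∩ closer G u v)

  -- The reply `a` rules out `v` and the reply `b` rules out `u`, so either reply costs a candidate.
  Separates : Fin m → Fin m → Fin m → Fin m → Set
  Separates u v a b = v ∉ closer G a b × u ∉ closer G b a

  -- While two candidates remain, a query separating them removes at least one of them.
  locate-by-separation : {Q : Rel (Fin m) 0ℓ} →
    (∀ {u v} → u ≢ v → ∃[ a ] ∃[ b ] Q a b × Separates u v a b) →
    ∀ t {S} → Nonempty S → ∣ S ∣ ≤ suc t → Locatable G Q t S
  locate-by-separation sep zero ne ∣S∣≤1 =
    located (≤-antisym ∣S∣≤1 (Nonempty⇒∣p∣≥1 ne))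
  locate-by-separation sep (suc t) ne ∣S∣≤ with singleton⊎distinct ne
  ... | inj₁ ∣S∣≡1 = located ∣S∣≡1
  ... | inj₂ (u , v , u∈S , v∈S , u≢v) with a , b , q , v∉ , u∉ ← sep u≢v =
    query a b q (continue v∈S v∉) (continue u∈S u∉)
    where
    continue : ∀ {x a b} → x ∈ _ → x ∉ closer G a b → Nonempty (_ ∩ closer G a b) → _
    continue x∈S x∉ ne′ =
      locate-by-separation sep t ne′ (s≤s⁻¹ (≤-trans (∣p∩q∣<∣p∣ x∈S x∉) ∣S∣≤))

  -- The first edge of a shortest walk from u to v separates them; if the first
  -- edge of the given walk does not, there is a shorter walk.
  separating-edge : ∀ {u v} → u ≢ v → ∀ b {k} → k ≤ b → Walk G u v k →
                    ∃[ a ] ∃[ c ] Adj a c × Separates u v a c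
  separating-edge u≢v b z≤n [] = contradiction refl u≢v
  separating-edge {u} {v} u≢v (suc b) (s≤s k≤b) (_∷_ {w = w} e p)
    with v ∈? closer G u w
  ... | no  v∉ = u , w , e , v∉ , v∉closer-u-v λ { refl → irreflexive refl e }
  ... | yes v∈ with l , l≤k , q ← ∈-closer⁻ u w v∈ p =
    separating-edge u≢v b (≤-trans l≤k k≤b) q

-- The digit graph: hub, tests and leaves

module DigitGraph (k : ℕ) where

  Auxiliary Vertex : Set
  Auxiliary = ⊤ ⊎ (Fin k × Fin 2)
  Vertex    = Auxiliary ⊎ Fin (2 ^ k)

  pattern hub      = inj₁ (inj₁ tt)
  pattern test i b = inj₁ (inj₂ (i , b))
  pattern leaf x   = inj₂ x

  c m : ℕ
  c = 1 + k * 2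
  m = c + 2 ^ k

  -- Only the inverse laws of these bijections are used below, so their unfolding is blocked.
  opaque
    auxiliaries : Fin c ↔ Auxiliary
    auxiliaries = (1↔⊤ ⊎-↔ *↔×) ↔-∘ +↔⊎ {1}

    vertices : Fin m ↔ Vertex
    vertices = (auxiliaries ⊎-↔ ↔-id _) ↔-∘ +↔⊎

  label : Fin m → Vertex
  label = Inverse.to vertices

  ⟨_⟩ : Vertex → Fin m
  ⟨_⟩ = Inverse.from vertices

  label-⟨⟩ : ∀ w → label ⟨ w ⟩ ≡ w
  label-⟨⟩ = Inverse.strictlyInverseˡ vertices

  ⟨⟩-label : ∀ v → ⟨ label v ⟩ ≡ v
  ⟨⟩-label = Inverse.strictlyInverseʳ vertices

  ⟨⟩-injective : ∀ {w w′} → ⟨ w ⟩ ≡ ⟨ w′ ⟩ → w ≡ w′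
  ⟨⟩-injective {w} {w′} eq =
    trans (sym (label-⟨⟩ w)) (trans (cong label eq) (label-⟨⟩ w′))

  digit : Fin (2 ^ k) → Fin k → Fin 2
  digit = finToFun {2} {k}

  -- Edges are oriented so that, when v ⟶ w is queried, the reply v discards no
  -- leaf other than w.
  data _⟶_ : Vertex → Vertex → Set where
    hub⟶test  : ∀ {i b} → hub ⟶ test i b
    hub⟶leaf  : ∀ {x} → hub ⟶ leaf x
    test⟶leaf : ∀ {i b x} → digit x i ≡ b → test i b ⟶ leaf x

  _⟶?_ : B.Decidable _⟶_
  hub      ⟶? hub      = no λ ()
  hub      ⟶? test i b = yes hub⟶test
  hub      ⟶? leaf x   = yes hub⟶leaf
  test i b ⟶? hub      = no λ ()
  test i b ⟶? test j d = no λ ()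
  test i b ⟶? leaf x   = map′ test⟶leaf (λ { (test⟶leaf eq) → eq }) (digit x i Fin.≟ b)
  leaf x   ⟶? hub      = no λ ()
  leaf x   ⟶? test i b = no λ ()
  leaf x   ⟶? leaf y   = no λ ()

  _~_ : Vertex → Vertex → Set
  v ~ w = v ⟶ w ⊎ w ⟶ v

  ~-irreflexive : ∀ {w} → ¬ (w ~ w)
  ~-irreflexive {hub}      = [ (λ ()) , (λ ()) ]′
  ~-irreflexive {test i b} = [ (λ ()) , (λ ()) ]′
  ~-irreflexive {leaf x}   = [ (λ ()) , (λ ()) ]′

  G : SimpleGraph m
  G = record
    { Adj         = λ u v → label u ~ label v
    ; adj?        = λ u v → label u ⟶? label v ⊎-dec label v ⟶? label u
    ; symmetric   = swap
    ; irreflexive = λ { refl → ~-irreflexive }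
    }
  open SimpleGraph G

  link : ∀ {v w} → v ~ w → Adj ⟨ v ⟩ ⟨ w ⟩
  link {v} {w} = subst₂ _~_ (sym (label-⟨⟩ v)) (sym (label-⟨⟩ w))

  unlink : ∀ v w → Adj ⟨ v ⟩ ⟨ w ⟩ → v ~ w
  unlink v w = subst₂ _~_ (label-⟨⟩ v) (label-⟨⟩ w)

  hub-or-neighbour : ∀ w → w ≡ hub ⊎ hub ⟶ w
  hub-or-neighbour hub        = inj₁ refl
  hub-or-neighbour (test i b) = inj₂ hub⟶test
  hub-or-neighbour (leaf x)   = inj₂ hub⟶leaf

  diameter≤2 : ∀ u v → ∃[ l ] l ≤ 2 × Walk G u v l
  diameter≤2 u v = subst₂ (λ u v → ∃[ l ] l ≤ 2 × Walk G u v l)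
                          (⟨⟩-label u) (⟨⟩-label v) (via-hub (label u) (label v))
    where
    from-hub : ∀ w → ∃[ l ] l ≤ 1 × Walk G ⟨ hub ⟩ ⟨ w ⟩ l
    from-hub w with hub-or-neighbour w
    ... | inj₁ refl = 0 , z≤n , []
    ... | inj₂ e    = 1 , ≤-refl , link (inj₁ e) ∷ []

    via-hub : ∀ w w′ → ∃[ l ] l ≤ 2 × Walk G ⟨ w ⟩ ⟨ w′ ⟩ l
    via-hub w w′ with hub-or-neighbour w | from-hub w′
    ... | inj₁ refl | l , l≤1 , p = l , m≤n⇒m≤1+n l≤1 , p
    ... | inj₂ e    | l , l≤1 , p = suc l , s≤s l≤1 , link (inj₂ e) ∷ p

  auxiliary : Fin c → Fin m
  auxiliary i = ⟨ inj₁ (Inverse.to auxiliaries i) ⟩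

  leaf-or-auxiliary : ∀ v → (∃[ x ] ⟨ leaf x ⟩ ≡ v) ⊎ ∃[ i ] auxiliary i ≡ v
  leaf-or-auxiliary v with label v | ⟨⟩-label v
  ... | inj₁ a | eq = inj₂ (Inverse.from auxiliaries a ,
    trans (cong (⟨_⟩ ∘ inj₁) (Inverse.strictlyInverseˡ auxiliaries a)) eq)
  ... | leaf x | eq = inj₁ (x , eq)

  -- Lower bound for edge queries

  walk₀ : ∀ {u v} → Walk G u v 0 → u ≡ v
  walk₀ [] = refl

  walk₁ : ∀ {u v} → Walk G u v 1 → Adj u v
  walk₁ (e ∷ []) = e

  -- A leaf other than `w` is at distance at least 1 from `w`, which suffices when `v` is the hub,
  -- adjacent to every leaf. If `v` is a test, then `w` is a leaf; leaves are pairwise non-adjacent,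
  -- so the distance from `w` is at least 2, the bound on the diameter.
  ⟶-keeps-leaves : ∀ {v w x} → v ⟶ w → ⟨ leaf x ⟩ ≢ ⟨ w ⟩ →
                   ⟨ leaf x ⟩ ∈ closer G ⟨ v ⟩ ⟨ w ⟩
  ⟶-keeps-leaves {v} {w} {x} v⟶w x≢w = ∈-closer⁺ G (reach v⟶w)
    where
    reach : ∀ {v} → v ⟶ w → ∀ {k} → Walk G ⟨ w ⟩ ⟨ leaf x ⟩ k →
            ∃[ l ] l ≤ k × Walk G ⟨ v ⟩ ⟨ leaf x ⟩ l
    reach _ {zero} p = contradiction (sym (walk₀ p)) x≢w
    reach hub⟶test {suc k} p = 1 , s≤s z≤n , link (inj₁ hub⟶leaf) ∷ []
    reach hub⟶leaf {suc k} p = 1 , s≤s z≤n , link (inj₁ hub⟶leaf) ∷ []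
    reach (test⟶leaf {x = y} _) {suc zero} p with unlink (leaf y) (leaf x) (walk₁ p)
    ... | inj₁ ()
    ... | inj₂ ()
    reach (test⟶leaf _) {suc (suc k)} p with l , l≤2 , q ← diameter≤2 _ _ =
      l , ≤-trans l≤2 (s≤s (s≤s z≤n)) , q

  OnlyLeaves : Subset m → Set
  OnlyLeaves T = ∀ {v} → v ∈ T → ∃[ x ] ⟨ leaf x ⟩ ≡ v

  edge-reply-keeps : ∀ u v {T} → OnlyLeaves T → label u ⟶ label v →
                     ∣ T ∣ ≤ suc ∣ T ∩ closer G u v ∣
  edge-reply-keeps u v {T} leaves u⟶v = covered 1 (λ _ → v) cov
    where
    cov : ∀ {y} → y ∈ T → y ∈ T ∩ closer G u v ⊎ Σ[ i ∈ Fin 1 ] v ≡ y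
    cov {y} y∈T with v Fin.≟ y | leaves y∈T
    ... | yes v≡y | _ = inj₂ (zero , v≡y)
    ... | no  v≢y | x , refl = inj₁ (x∈p∩q⁺ (y∈T ,
      subst₂ (λ u v → _ ∈ closer G u v) (⟨⟩-label u) (⟨⟩-label v)
        (⟶-keeps-leaves u⟶v λ eq → v≢y (sym (trans eq (⟨⟩-label v))))))

  -- The adversary always replies with the tail of the oriented edge and so loses at most one leaf
  -- of `T` per query. Tracking `T` inside `S` leaves the surviving hub and tests out of the count.
  locatable-∣leaves∣≤ : ∀ {t S T} → T ⊆ S → OnlyLeaves T →
                        Locatable G Adj t S → ∣ T ∣ ≤ suc t
  locatable-∣leaves∣≤ T⊆S leaves (located ∣S∣≡1) =
    ≤-trans (p⊆q⇒∣p∣≤∣q∣ T⊆S) (≤-trans (≤-reflexive ∣S∣≡1) (s≤s z≤n))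
  locatable-∣leaves∣≤ {suc t} {S} {T} T⊆S leaves (query u v e l r) =
    -- The orientation of the queried edge selects the reply.
    [ after u v l , after v u r ]′ e
    where
    after : ∀ u v → (Nonempty (S ∩ closer G u v) → Locatable G Adj t (S ∩ closer G u v)) →
            label u ⟶ label v → ∣ T ∣ ≤ suc (suc t)
    after u v next u⟶v =
      ≤-trans (edge-reply-keeps u v leaves u⟶v) (s≤s bound)
      where
      C = closer G u v
      T∩C⊆S∩C : T ∩ C ⊆ S ∩ C
      T∩C⊆S∩C x∈ = x∈p∩q⁺ (T⊆S (p∩q⊆p T C x∈) , p∩q⊆q T C x∈)
      bound : ∣ T ∩ C ∣ ≤ suc t
      bound with nonempty? (T ∩ C)
      ... | yes (x , x∈) =
        locatable-∣leaves∣≤ T∩C⊆S∩C (leaves ∘ p∩q⊆p T C) (next (x , T∩C⊆S∩C x∈))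
      ... | no empty =
        ≤-trans (≤-reflexive (trans (cong ∣_∣ (Empty-unique empty)) (∣⊥∣≡0 m))) z≤n

  side : Vertex → Side
  side (inj₁ _) = outside
  side (leaf _) = inside

  leaves : Subset m
  leaves = tabulate (side ∘ label)

  leaves-onlyLeaves : OnlyLeaves leaves
  leaves-onlyLeaves {v} v∈
    with label v | ⟨⟩-label v | trans (sym (lookup∘tabulate (side ∘ label) v)) ([]=⇒lookup v∈)
  ... | inj₁ _ | _  | ()
  ... | leaf x | eq | _ = x , eq

  leaf∈leaves : ∀ x → ⟨ leaf x ⟩ ∈ leaves
  leaf∈leaves x = lookup⇒[]= _ leaves (trans (lookup∘tabulate (side ∘ label) ⟨ leaf x ⟩)
    (cong side (label-⟨⟩ (leaf x))))

  -- The `c` auxiliary vertices cover everything outside `leaves`, and there are `c + 2 ^ k`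
  -- vertices in total.
  2^k≤∣leaves∣ : 2 ^ k ≤ ∣ leaves ∣
  2^k≤∣leaves∣ = +-cancelˡ-≤ c _ _
    (subst (_≤ c + ∣ leaves ∣) (∣⊤∣≡n m) (covered c auxiliary {p = full} cov))
    where
    cov : ∀ {v} → v ∈ full → v ∈ leaves ⊎ ∃[ i ] auxiliary i ≡ v
    cov {v} _ with leaf-or-auxiliary v
    ... | inj₁ (x , refl) = inj₁ (leaf∈leaves x)
    ... | inj₂ aux        = inj₂ aux

  edge-queries-≥ : ∀ {t} → Locatable G Adj t full → 2 ^ k ≤ suc t
  edge-queries-≥ loc =
    ≤-trans 2^k≤∣leaves∣ (locatable-∣leaves∣≤ (λ _ → ∈⊤) leaves-onlyLeaves loc)

  -- Strategies for edge queries and for pair queries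

  full-nonempty : Nonempty (full {m})
  full-nonempty = ⟨ hub ⟩ , ∈⊤

  -- Ensures that eq(G) exists, by giving `least` a starting point; the bound is not meant to be
  -- sharp.
  edge-locatable : Locatable G Adj m full
  edge-locatable = locate-by-separation G separate m full-nonempty
    (≤-trans (≤-reflexive (∣⊤∣≡n m)) (n≤1+n m))
    where
    separate : ∀ {u v} → u ≢ v → ∃[ a ] ∃[ b ] Adj a b × Separates G u v a b
    separate {u} {v} u≢v with l , _ , p ← diameter≤2 u v =
      separating-edge G u≢v l ≤-refl p

  -- A leaf with digit `d` is adjacent to `test i d`. To be kept it must be within distance 1 of
  -- `test i b` as well, hence adjacent to it, which forces the digit to be `b`.
  reply⇒digit : ∀ i b d {x} → (∀ e → e ≡ b ⊎ e ≡ d) →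
    ⟨ leaf x ⟩ ∈ closer G ⟨ test i b ⟩ ⟨ test i d ⟩ → digit x i ≡ b
  reply⇒digit i b d {x} b-or-d x∈ with b-or-d (digit x i)
  ... | inj₁ eq = eq
  ... | inj₂ eq with ∈-closer⁻ G ⟨ test i b ⟩ ⟨ test i d ⟩ x∈ (link (inj₁ (test⟶leaf eq)) ∷ [])
  ... | zero , _ , p with () ← ⟨⟩-injective {test i b} {leaf x} (walk₀ p)
  ... | suc zero , _ , p with unlink (test i b) (leaf x) (walk₁ p)
  ...   | inj₁ (test⟶leaf eq′) = eq′
  ...   | inj₂ ()
  reply⇒digit _ _ _ _ x∈ | inj₂ eq | suc (suc _) , s≤s () , _

  -- Constrains only the leaves in `S`; the hub and the tests may survive any of the digit queries.
  Known : Subset m → Fin k → Set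
  Known S i = ∃[ b ] (∀ {x} → ⟨ leaf x ⟩ ∈ S → digit x i ≡ b)

  known-⊆ : ∀ {S T i} → T ⊆ S → Known S i → Known T i
  known-⊆ T⊆S (b , eq) = b , eq ∘ T⊆S

  -- The known digits spell out a single leaf `r`, so `S` lies within `r` and the `c` auxiliary
  -- vertices.
  all-known⇒∣S∣≤ : ∀ {S} → (∀ i → Known S i) → ∣ S ∣ ≤ suc c
  all-known⇒∣S∣≤ {S} known = begin
    ∣ S ∣                ≤⟨ covered c auxiliary cov ⟩
    c + ∣ ⁅ ⟨ leaf r ⟩ ⁆ ∣ ≡⟨ cong (c +_) (∣⁅x⁆∣≡1 ⟨ leaf r ⟩) ⟩
    c + 1                ≡⟨ +-comm c 1 ⟩
    suc c                ∎
    where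
    open ≤-Reasoning
    r : Fin (2 ^ k)
    r = funToFin (proj₁ ∘ known)
    cov : ∀ {v} → v ∈ S → v ∈ ⁅ ⟨ leaf r ⟩ ⁆ ⊎ ∃[ i ] auxiliary i ≡ v
    cov {v} v∈S with leaf-or-auxiliary v
    ... | inj₂ aux        = inj₂ aux
    ... | inj₁ (x , refl) = inj₁ (subst (λ y → ⟨ leaf x ⟩ ∈ ⁅ ⟨ leaf y ⟩ ⁆) x≡r (x∈⁅x⁆ _))
      where
      x≡r : x ≡ r
      x≡r = trans (sym (funToFin-finToFin {k} {2} x))
                  (funToFin-cong λ i → proj₂ (known i) v∈S)

  -- `is` lists the digits still to be queried, one query each; the last `c` queries reduce the at
  -- most `suc c` remaining candidates to one.
  locate-by-digits : ∀ is {S} → Nonempty S → (∀ i → i ∈ˡ is ⊎ Known S i) →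
                     Locatable G (λ _ _ → ⊤) (length is + c) S
  locate-by-digits [] ne known = locate-by-separation G
    -- Two candidates are queried against each other: each is at distance 0 from itself only, so the
    -- reply discards the other.
    (λ {u} {v} u≢v → u , v , tt , v∉closer-u-v G u≢v , v∉closer-u-v G (u≢v ∘ sym))
    c ne (all-known⇒∣S∣≤ λ i → [ (λ ()) , (λ kn → kn) ]′ (known i))
  locate-by-digits (i ∷ is) {S} ne known =
    query ⟨ test i zero ⟩ ⟨ test i (suc zero) ⟩ tt
      (continue zero (suc zero) λ { zero → inj₁ refl ; (suc zero) → inj₂ refl })
      (continue (suc zero) zero λ { zero → inj₂ refl ; (suc zero) → inj₁ refl })
    where
    continue : ∀ b d → (∀ e → e ≡ b ⊎ e ≡ d) →
      let S′ = S ∩ closer G ⟨ test i b ⟩ ⟨ test i d ⟩ in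
      Nonempty S′ → Locatable G (λ _ _ → ⊤) (length is + c) S′
    continue b d b-or-d ne′ = locate-by-digits is ne′ known′
      where
      C = closer G ⟨ test i b ⟩ ⟨ test i d ⟩
      known′ : ∀ j → j ∈ˡ is ⊎ Known (S ∩ C) j
      known′ j with known j
      ... | inj₁ (here refl) = inj₂ (b , reply⇒digit i b d b-or-d ∘ p∩q⊆q S C)
      ... | inj₁ (there j∈)  = inj₁ j∈
      ... | inj₂ kn          = inj₂ (known-⊆ (p∩q⊆p S C) kn)

  pair-locatable : Locatable G (λ _ _ → ⊤) (k + c) full
  pair-locatable = subst (λ l → Locatable G (λ _ _ → ⊤) (l + c) full)
    (length-tabulate {n = k} (λ i → i))
    (locate-by-digits (allFin k) full-nonempty (inj₁ ∘ ∈-allFin))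

-- Choice of `k` and the constants

2^k≤n<2^1+k : ∀ n → ∃[ k ] 2 ^ k ≤ suc n × suc n < 2 ^ suc k
2^k≤n<2^1+k zero = 0 , ≤-refl , ≤-refl
2^k≤n<2^1+k (suc n) with k , lo , hi ← 2^k≤n<2^1+k n with 2 ^ suc k ≤? suc (suc n)
... | no  ≰ = k , m≤n⇒m≤1+n lo , ≰⇒> ≰
... | yes ≤ = suc k , ≤ , (begin-strict
    suc (suc n)   ≤⟨ hi ⟩
    2 ^ suc k     <⟨ ^-monoʳ-< 2 ≤-refl (n<1+n (suc k)) ⟩
    2 ^ suc (suc k) ∎)
  where open ≤-Reasoning

n<2^n : ∀ n → n < 2 ^ n
n<2^n zero    = ≤-refl
n<2^n (suc n) = begin
  suc (suc n)   ≤⟨ s≤s (n<2^n n) ⟩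
  1 + 2 ^ n     ≤⟨ +-monoˡ-≤ (2 ^ n) (m^n>0 2 n) ⟩
  2 ^ n + 2 ^ n ≡⟨ cong (2 ^ n +_) (sym (+-identityʳ (2 ^ n))) ⟩
  2 ^ suc n     ∎
  where open ≤-Reasoning

mainTheorem9 : ∃[ a ] ∃[ b ] ∃[ c ] ∃[ d ]
    (∀ (n : ℕ) → 2 ≤ n →
    ∃[ m ] Σ[ G ∈ SimpleGraph m ] ∃[ e ] ∃[ p ]
    ( IsEq G e × IsPq G p
    × n ≤ a * m × m ≤ b * n
    × n ≤ c * e
    × p ≤ d * ⌊log₂ n ⌋ ))
-- With `2 ^ k ≤ n < 2 ^ suc k`: `n ≤ 2 * 2 ^ k ≤ 2 * m`; `m ≤ 3 * 2 ^ k ≤ 3 * n`;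
-- `n ≤ 2 * (1 + e) ≤ 4 * e`; and `p ≤ k + c = 3 * k + 1 ≤ 4 * k`.
mainTheorem9 = 2 , 3 , 4 , 4 , bounds
  where
  bounds : ∀ n → 2 ≤ n →
    ∃[ m ] Σ[ G ∈ SimpleGraph m ] ∃[ e ] ∃[ p ]
    ( IsEq G e × IsPq G p
    × n ≤ 2 * m × m ≤ 3 * n
    × n ≤ 4 * e
    × p ≤ 4 * ⌊log₂ n ⌋ )
  bounds (suc zero) (s≤s ())
  bounds n@(suc (suc n′)) _ with 2^k≤n<2^1+k (suc n′)
  -- As `n` is at least 2, `k` is positive; this yields `1 ≤ e` and absorbs the `1` of `c` into `k`.
  ... | zero , _ , s≤s (s≤s ())
  ... | k@(suc k′) , lo , hi = m , G , e , p , isEq , isPq , n≤2m , m≤3n , n≤4e , p≤4log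
    where
    open DigitGraph k
    open SimpleGraph G
    open ≤-Reasoning

    eq : ∃[ e ] IsEq G e
    eq = least (λ t → locatable? G adj? t full) m edge-locatable
    e = proj₁ eq
    isEq = proj₂ eq

    pq : ∃[ p ] IsPq G p
    pq = least (λ t → locatable? G (λ _ _ → yes tt) t full) (k + c) pair-locatable
    p = proj₁ pq
    isPq = proj₂ pq

    n≤2m : n ≤ 2 * m
    n≤2m = ≤-trans (<⇒≤ hi) (*-monoʳ-≤ 2 (m≤n+m (2 ^ k) c))

    m≤3n : m ≤ 3 * n
    m≤3n = begin
      1 + k * 2 + 2 ^ k     ≤⟨ +-monoˡ-≤ (2 ^ k) (n≤1+n (1 + k * 2)) ⟩
      suc k * 2 + 2 ^ k     ≤⟨ +-monoˡ-≤ (2 ^ k) (*-monoˡ-≤ 2 (n<2^n k)) ⟩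
      2 ^ k * 2 + 2 ^ k     ≡⟨ cong (_+ 2 ^ k) (*-comm (2 ^ k) 2) ⟩
      2 * 2 ^ k + 2 ^ k     ≡⟨ +-comm (2 * 2 ^ k) (2 ^ k) ⟩
      3 * 2 ^ k             ≤⟨ *-monoʳ-≤ 3 lo ⟩
      3 * n                 ∎

    2^k≤1+e : 2 ^ k ≤ suc e
    2^k≤1+e = edge-queries-≥ (proj₁ isEq)

    1≤e : 1 ≤ e
    1≤e = s≤s⁻¹ (≤-trans (*-monoʳ-≤ 2 (m^n>0 2 k′)) 2^k≤1+e)

    n≤4e : n ≤ 4 * e
    n≤4e = begin
      n           ≤⟨ <⇒≤ hi ⟩
      2 * 2 ^ k   ≤⟨ *-monoʳ-≤ 2 2^k≤1+e ⟩
      2 * (1 + e) ≤⟨ *-monoʳ-≤ 2 (+-monoˡ-≤ e 1≤e) ⟩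
      2 * (e + e) ≡⟨ cong (λ x → 2 * (e + x)) (sym (+-identityʳ e)) ⟩
      2 * (2 * e) ≡⟨ sym (*-assoc 2 2 e) ⟩
      4 * e       ∎

    k≤log : k ≤ ⌊log₂ n ⌋
    k≤log = subst (_≤ ⌊log₂ n ⌋) (⌊log₂[2^n]⌋≡n k) (⌊log₂⌋-mono-≤ lo)

    p≤4log : p ≤ 4 * ⌊log₂ n ⌋
    p≤4log = begin
      p                   ≤⟨ proj₂ isPq (k + c) pair-locatable ⟩
      k + (1 + k * 2)     ≤⟨ +-monoʳ-≤ k (+-monoˡ-≤ (k * 2) (s≤s z≤n)) ⟩
      k + (k + k * 2)     ≡⟨ cong (λ x → k + (k + x)) (*-comm k 2) ⟩
      4 * k               ≤⟨ *-monoʳ-≤ 4 k≤log ⟩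
      4 * ⌊log₂ n ⌋       ∎
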